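{- Let $\mathbb{M}=\langle V,D,\cdot_{\mathbb{M}}\rangle$ be a $\Sigma$-PNmatrix and let $\mathsf{Ax}\subseteq L_\Sigma(P)$. Suppose there exists $\Sigma^d\subseteq\Sigma$ such that $\mathbb{M}$ is a rexpansion of some $\Sigma^d$-deterministic $\Sigma$-PNmatrix, and all formulas in $\mathsf{Ax}$ are $\Sigma^d$-simple. Let $\Theta_{\mathsf{Ax}}$ be the look-ahead set induced by $\mathsf{Ax}$, let $\mathrm{Val}_{\mathbb{M}}^{\mathsf{Ax}}=\{v\in\mathrm{Val}_{\mathbb{M}}: v(\mathsf{Ax}^{\mathsf{inst}})\subseteq D\}$, and for $v\in\mathrm{Val}_{\mathbb{M}}$ and $A\in L_\Sigma(P)$ let $f^A_v:\Theta_{\mathsf{Ax}}\to V$ be given by $f^A_v(w)=v(wA)$. Define $\mathbb{M}^\sharp_{\mathsf{Ax}}=\langle V^\sharp_{\mathsf{Ax}},D^\sharp_{\mathsf{Ax}},\cdot_{\mathbb{M}^\sharp_{\mathsf{Ax}}}\rangle$ by \begin{itemize} \item $V^\sharp_{\mathsf{Ax}}=\bigcup_{v\in\mathrm{Val}_{\mathbb{M}}^{\mathsf{Ax}}}\{f^A_v:A\in L_\Sigma(P)\}$, \item $D^\sharp_{\mathsf{Ax}}=\{f\in V^\sharp_{\mathsf{Ax}}:f(\varepsilon)\in D\}$, \item for each $k\in\mathbb{N}$ and each $c\in\Sigma^{(k)}$, $$c_{\mathbb{M}^\sharp_{\mathsf{Ax}}}(f_1,\dots,f_k)=\bigcup_{v\in\mathrm{Val}_{\mathbb{M}}^{\mathsf{Ax}}}\{f^{c(A_1,\dots,A_k)}_v:A_i\in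 L_\Sigma(P)\text{ with }f^{A_i}_v=f_i\text{ for }1\leq i\leq k\}.$$ \end{itemize} Then $\mathbb{M}^\sharp_{\mathsf{Ax}}$ is a rexpansion of $\mathbb{M}$, and the consequence relation $\vdash_{\mathbb{M}}^{\mathsf{Ax}}$ is characterized by $\mathbb{M}^\sharp_{\mathsf{Ax}}$, that is, $\vdash_{\mathbb{M}}^{\mathsf{Ax}}\;=\;\vdash_{\mathbb{M}^\sharp_{\mathsf{Ax}}}$.
   Context: A signature $\Sigma$ is a family $\{\Sigma^{(k)}\}_{k\in\mathbb{N}}$ of sets, $\Sigma^{(k)}$ being the set of $k$-place connectives; $\Sigma^d\subseteq\Sigma$ means componentwise inclusion. $L_\Sigma(P)$ is the set of formulas (the absolutely free $\Sigma$-algebra) over a fixed denumerable set $P$ of sentential variables; for $Q\subseteq P$, $L_\Sigma(Q)$ is the set of formulas with variables in $Q$. A substitution is a function $\sigma:P\to L_\Sigma(P)$; $A^\sigma$ is the result of applying (the endomorphism extending) $\sigma$ to $A$. For $\Gamma\subseteq L_\Sigma(P)$, $\Gamma^{\mathsf{inst}}=\{A^\sigma: A\in\Gamma,\ \sigma:P\to L_\Sigma(P)\}$. A $\Sigma$-PNmatrix (partial non-deterministic matrix) is $\mathbb{M}=\langle V,D,\cdot_{\mathbb{M}}\rangle$ with $V$ a set (truth-values), $D\subseteq V$ (designated values), and, for each $k$ and each $c\in\Sigma^{(k)}$, a function $c_{\mathbb{M}}:V^k\to\wp(V)$ (the empty set is an allowed output). It is $\Sigma'$-deterministic, for $\Sigma'\subseteq\Sigma$,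 if $c_{\mathbb{M}}(x_1,\dots,x_k)$ has at most one element for every $k$, every $c\in\Sigma'^{(k)}$ and all $x_1,\dots,x_k\in V$. An $\mathbb{M}$-valuation is a function $v:L_\Sigma(P)\to V$ with $v(c(A_1,\dots,A_k))\in c_{\mathbb{M}}(v(A_1),\dots,v(A_k))$ for all $k$, all $c\in\Sigma^{(k)}$ and all formulas $A_1,\dots,A_k$; $\mathrm{Val}_{\mathbb{M}}$ is the set of all $\mathbb{M}$-valuations. The consequence relation characterized by $\mathbb{M}$ is: $\Gamma\vdash_{\mathbb{M}}A$ iff for every $v\in\mathrm{Val}_{\mathbb{M}}$, $v(\Gamma)\subseteq D$ implies $v(A)\in D$. The strengthening of $\vdash_{\mathbb{M}}$ with (schema) axioms $\mathsf{Ax}$ is: $\Gamma\vdash_{\mathbb{M}}^{\mathsf{Ax}}A$ iff $\Gamma\cup\mathsf{Ax}^{\mathsf{inst}}\vdash_{\mathbb{M}}A$. Rexpansions: a refinement of $\mathbb{M}=\langle V,D,\cdot_{\mathbb{M}}\rangle$ is any $\Sigma$-PNmatrix $\mathbb{M}'=\langle V',D',\cdot_{\mathbb{M}'}\rangle$ with $V'\subseteq V$, $D'=D\cap V'$ and $c_{\mathbb{M}'}(x_1,\dots,x_k)\subseteq c_{\mathbb{M}}(x_1,\dots,x_k)$ for all $c\in\Sigma^{(k)}$ and $x_1,\dots,x_k\in V'$. An expansion function is $\mathcal{E}:V\to\wp(U)$ (for some set $U$) with $\mathcal{E}(x)\neq\emptyset$ for all $x\in V$ and $\mathcal{E}(x)\cap\mathcal{E}(x')=\emptyset$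 for $x\neq x'$; put $\mathcal{E}(X)=\bigcup_{x\in X}\mathcal{E}(x)$ for $X\subseteq V$, and let $\widetilde{\mathcal{E}}:\mathcal{E}(V)\to V$ send $y$ to the unique $x$ with $y\in\mathcal{E}(x)$. The $\mathcal{E}$-expansion of $\mathbb{M}$ is $\mathcal{E}(\mathbb{M})=\langle\mathcal{E}(V),\mathcal{E}(D),\cdot_{\mathcal{E}(\mathbb{M})}\rangle$ with $c_{\mathcal{E}(\mathbb{M})}(y_1,\dots,y_k)=\mathcal{E}(c_{\mathbb{M}}(\widetilde{\mathcal{E}}(y_1),\dots,\widetilde{\mathcal{E}}(y_k)))$. A rexpansion of $\mathbb{M}$ is a refinement of some $\mathcal{E}$-expansion of $\mathbb{M}$. Simple formulas and look-ahead: given $\Sigma^d\subseteq\Sigma$, let $\mathcal{U}$ be the set of all 1-place connectives of $\Sigma$ not in $\Sigma^d$, and $\mathcal{U}^*$ the set of finite strings over $\mathcal{U}$, with empty string $\varepsilon$; $\mathsf{prfx}(w)$ is the set of all prefixes of $w$, including $\varepsilon$ (and $w$ itself). For $w\in\mathcal{U}^*$ and a formula $A$, the formula $wA$ is defined by $\varepsilon A=A$ and $(\bullet w)A=\bullet(wA)$ for $\bullet\in\mathcal{U}$. For distinct variables $p_1,p_2,\dots$ and a $k$-place connective $c\in\Sigma$, a $\Sigma^d$-simple formula based on $c$ is a formula $B\in L_\Sigma(\{p_1,\dots,p_k\})$ such that $B=A^\sigma$ for some structure formula $A\in L_{\Sigma^d}(\{q_1,\dots,q_n,r_1,\dots,r_m\})$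 (with $q_1,\dots,q_n,r_1,\dots,r_m$ distinct variables, not all of which need to occur in $A$) and some substitution $\sigma$ such that: for each $1\le i\le n$, $\sigma(q_i)=w_ip_j$ for some $w_i\in\mathcal{U}^*$ and some $1\le j\le k$; and for each $1\le l\le m$, $\sigma(r_l)=u_l\,c(p_1,\dots,p_k)$ for some $u_l\in\mathcal{U}^*$. The look-ahead set induced by $B$ is $\Theta_B=\bigcup_{i=1}^n\mathsf{prfx}(w_i)\cup\bigcup_{l=1}^m\mathsf{prfx}(u_l)$, computed from a fixed choice of such $A,\sigma$ for $B$. A formula is $\Sigma^d$-simple if it is $\Sigma^d$-simple based on some connective of $\Sigma$. For a set $\Gamma$ of $\Sigma^d$-simple formulas, $\Theta_\Gamma=\{\varepsilon\}\cup\bigcup_{B\in\Gamma}\Theta_B$. -}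

module Defs where

open import Data.Fin.Base using (Fin)
open import Data.List.Base as List using (List)
open import Data.List.Relation.Binary.Prefix.Heterogeneous using (Prefix)
open import Data.Nat.Base using (ℕ)
open import Data.Product using (Σ; ∃; ∃-syntax; _×_; _,_; proj₁; proj₂)
open import Data.Refinement using (Refinement-syntax; value; _,_)
import Data.Irrelevant as Irr
open import Data.Sum using (_⊎_; inj₁)
open import Data.Vec.Base as Vec using (Vec; []; _∷_)
open import Data.Vec.Membership.Propositional as VecMem using ()
open import Data.Vec.Relation.Binary.Pointwise.Inductive as Pointwise
  using (Pointwise)
open import Data.Vec.Relation.Unary.All using (All)
open import Data.Vec.Relation.Unary.Unique.Propositional using (Unique)
open import Function.Base using (_∘_)
open import Function.Bundles using (Injection; _⇔_)
open import Level using (Level; _⊔_; suc)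
open import Relation.Binary.Bundles using (Setoid)
open import Relation.Binary.PropositionalEquality.Core using (_≡_; refl)
open import Relation.Nullary.Negation.Core using (¬_)
open import Relation.Unary using (Pred; U; _∈_; _⊆_; _∪_)

private
  variable
    ℓ ℓ₁ ℓ₂ : Level

Signature : (ℓ : Level) → Set (suc ℓ)
Signature ℓ = ℕ → Set ℓ

SubSignature : Signature ℓ → (ℓ₁ : Level) → Set (ℓ ⊔ suc ℓ₁)
SubSignature S ℓ₁ = ∀ k → Pred (S k) ℓ₁

-- The fixed denumerable set P of sentential variables.
Var : Set
Var = ℕ

data Formula (S : Signature ℓ) : Set ℓ where
  var : Var → Formula S
  con : ∀ {k} → S k → Vec (Formula S) k → Formula S

-- L Sd Q is the set of formulas built from variables in Q with connectives
-- in Sd only, as a subset of the formulas over S.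
data L {S : Signature ℓ} (Sd : SubSignature S ℓ₁) (Q : Pred Var ℓ₂)
       : Pred (Formula S) (ℓ ⊔ ℓ₁ ⊔ ℓ₂) where
  var : ∀ {x} → x ∈ Q → L Sd Q (var x)
  con : ∀ {k} {c : S k} {As} → c ∈ Sd k → All (L Sd Q) As → L Sd Q (con c As)

Substitution : Signature ℓ → Set ℓ
Substitution S = Var → Formula S

module _ {S : Signature ℓ} where

  infix 8 _⟪_⟫ _⟪_⟫*

  mutual
    _⟪_⟫ : Formula S → Substitution S → Formula S
    var x    ⟪ σ ⟫ = σ x
    con c As ⟪ σ ⟫ = con c (As ⟪ σ ⟫*)

    _⟪_⟫* : ∀ {k} → Vec (Formula S) k → Substitution S → Vec (Formula S) k
    []       ⟪ σ ⟫* = []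
    (A ∷ As) ⟪ σ ⟫* = A ⟪ σ ⟫ ∷ As ⟪ σ ⟫*

  _inst : Pred (Formula S) ℓ → Pred (Formula S) ℓ
  (Γ inst) B = ∃[ A ] ∃[ σ ] A ∈ Γ × B ≡ A ⟪ σ ⟫

-- The sets of truth-values are setoids, because the values of the
-- strengthened matrix below are functions, to be compared extensionally.
record PNmatrix (S : Signature ℓ) : Set (suc ℓ) where
  field
    𝕍 : Setoid ℓ ℓ
  open Setoid 𝕍 public using (_≈_) renaming (Carrier to V)
  field
    D       : Pred V ℓ
    D-resp  : ∀ {x y} → x ≈ y → x ∈ D → y ∈ D
    op      : ∀ {k} → S k → Vec V k → Pred V ℓ
    op-resp : ∀ {k} (c : S k) {xs ys} {x y} → Pointwise _≈_ xs ys → x ≈ y →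
              x ∈ op c xs → y ∈ op c ys

module _ {S : Signature ℓ} where

  Deterministic : SubSignature S ℓ₁ → PNmatrix S → Set (ℓ ⊔ ℓ₁)
  Deterministic Sd M = ∀ {k} (c : S k) → c ∈ Sd k →
    ∀ xs {y z} → y ∈ op c xs → z ∈ op c xs → y ≈ z
    where open PNmatrix M

  record Valuation (M : PNmatrix S) : Set ℓ where
    open PNmatrix M
    field
      ⟦_⟧    : Formula S → V
      ⟦⟧-con : ∀ {k} (c : S k) As → ⟦ con c As ⟧ ∈ op c (Vec.map ⟦_⟧ As)

  open Valuation

  infix 4 _⊢[_]_ _⊢[_⊹_]_

  _⊢[_]_ : Pred (Formula S) ℓ → PNmatrix S → Formula S → Set ℓ
  Γ ⊢[ M ] A = (v : Valuation M) → Γ ⊆ D ∘ ⟦ v ⟧ → ⟦ v ⟧ A ∈ D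
    where open PNmatrix M

  _⊢[_⊹_]_ : Pred (Formula S) ℓ → PNmatrix S → Pred (Formula S) ℓ →
             Formula S → Set ℓ
  Γ ⊢[ M ⊹ Ax ] A = Γ ∪ Ax inst ⊢[ M ] A

  -- Inclusion of sets of truth-values is rendered as an injection of setoids.
  -- Images of expansion functions can be renamed at will, so the notion of
  -- rexpansion is unaffected.
  record _RefinementOf_ (M′ M : PNmatrix S) : Set ℓ where
    private
      module M′ = PNmatrix M′
      module M  = PNmatrix M
    field
      incl : Injection M′.𝕍 M.𝕍
    open Injection incl public using (to)
    field
      D-incl  : ∀ x → x ∈ M′.D ⇔ to x ∈ M.D
      op-incl : ∀ {k} (c : S k) xs {y} → y ∈ M′.op c xs →
                to y ∈ M.op c (Vec.map to xs)

-- Disjointness of E x and E x′ for distinct x, x′ is stated positively, which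
-- is what makes the inverse of E below well defined without excluded middle.
record ExpansionFunction (𝕍 𝕌 : Setoid ℓ ℓ) : Set (suc ℓ) where
  private
    module V = Setoid 𝕍
    module U = Setoid 𝕌
  field
    E        : V.Carrier → Pred U.Carrier ℓ
    E-resp   : ∀ {x x′ y y′} → x V.≈ x′ → y U.≈ y′ → y ∈ E x → y′ ∈ E x′
    nonempty : ∀ x → ∃[ y ] y ∈ E x
    disjoint : ∀ {x x′ y} → y ∈ E x → y ∈ E x′ → x V.≈ x′

  Image : Set ℓ
  Image = ∃[ y ] ∃[ x ] y ∈ E x

  Ẽ : Image → V.Carrier
  Ẽ (_ , x , _) = x

  imageSetoid : Setoid ℓ ℓ
  imageSetoid = record
    { Carrier       = Image
    ; _≈_           = λ y y′ → proj₁ y U.≈ proj₁ y′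
    ; isEquivalence = record { refl = U.refl ; sym = U.sym ; trans = U.trans }
    }

  Ẽ-cong : ∀ {y y′ : Image} → proj₁ y U.≈ proj₁ y′ → Ẽ y V.≈ Ẽ y′
  Ẽ-cong {_ , _ , y∈Ex} {_ , _ , y′∈Ex′} y≈y′ =
    disjoint (E-resp V.refl y≈y′ y∈Ex) y′∈Ex′

module _ {S : Signature ℓ} where

  expand : (M : PNmatrix S) {𝕌 : Setoid ℓ ℓ} →
           ExpansionFunction (PNmatrix.𝕍 M) 𝕌 → PNmatrix S
  expand M {𝕌} ℰ = record
    { 𝕍       = imageSetoid
    ; D       = λ y → ∃[ x ] x ∈ D × proj₁ y ∈ E x
    ; D-resp  = λ y≈y′ (x , x∈D , y∈Ex) → x , x∈D , E-resp V.refl y≈y′ y∈Ex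
    ; op      = λ c ys z → ∃[ x ] x ∈ op c (Vec.map Ẽ ys) × proj₁ z ∈ E x
    ; op-resp = λ c {ys} {ys′} {z} {z′} ys≈ys′ z≈z′ (x , x∈ , z∈Ex) →
        x
      , op-resp c
          (Pointwise.map⁺ (λ {y} {y′} → Ẽ-cong {y} {y′}) ys≈ys′) V.refl x∈
      , E-resp V.refl z≈z′ z∈Ex
    }
    where
    open PNmatrix M
    open ExpansionFunction ℰ
    module V = Setoid 𝕍

  _RexpansionOf_ : PNmatrix S → PNmatrix S → Set (suc ℓ)
  M′ RexpansionOf M = ∃[ 𝕌 ] Σ (ExpansionFunction (PNmatrix.𝕍 M) 𝕌)
    λ ℰ → M′ RefinementOf expand M ℰ

module _ {S : Signature ℓ} (Sd : SubSignature S ℓ) where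

  𝒰 : Set ℓ
  𝒰 = [ c ∈ S 1 ∣ ¬ c ∈ Sd 1 ]

  infixr 8 _·_

  _·_ : List 𝒰 → Formula S → Formula S
  List.[]      · A = A
  (b List.∷ w) · A = con (value b) (w · A ∷ [])

  record SimpleBasedOn {k} (c : S k) (B : Formula S) : Set ℓ where
    field
      p          : Vec Var k
      p-distinct : Unique p
      B∈L        : B ∈ L (λ _ → U) (VecMem._∈ p)
      n m        : ℕ
      q          : Vec Var n
      r          : Vec Var m
      distinct   : Unique (q Vec.++ r)
      A          : Formula S
      A∈L        : A ∈ L Sd (VecMem._∈ q Vec.++ r)
      σ          : Substitution S
      B≡Aσ       : B ≡ A ⟪ σ ⟫
      w          : Fin n → List 𝒰
      j          : Fin n → Fin k
      σq         : ∀ i → σ (Vec.lookup q i) ≡ w i · var (Vec.lookup p (j i))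
      u          : Fin m → List 𝒰
      σr         : ∀ l → σ (Vec.lookup r l) ≡ u l · con c (Vec.map var p)

  Simple : Formula S → Set ℓ
  Simple B = ∃[ k ] Σ (S k) λ c → SimpleBasedOn c B

module _ {S : Signature ℓ} {Sd : SubSignature S ℓ} where

  LookAhead : ∀ {B} → Simple Sd B → Pred (List (𝒰 Sd)) ℓ
  LookAhead (_ , _ , s) x =
    (∃[ i ] Prefix _≡_ x (w i)) ⊎ (∃[ l ] Prefix _≡_ x (u l))
    where open SimpleBasedOn s

  -- The argument is the fixed choice of structure formula and substitution
  -- for each element of the set.
  LookAheadSet : {Ax : Pred (Formula S) ℓ} → (∀ {B} → B ∈ Ax → Simple Sd B) →
                 Pred (List (𝒰 Sd)) ℓ
  LookAheadSet {Ax} simple x =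
    x ≡ List.[] ⊎ (∃[ B ] Σ (B ∈ Ax) λ B∈Ax → x ∈ LookAhead (simple B∈Ax))

module Strengthening
  {S : Signature ℓ} (M : PNmatrix S) (Ax : Pred (Formula S) ℓ)
  {Sd : SubSignature S ℓ} (simple : ∀ {B} → B ∈ Ax → Simple Sd B)
  where

  open PNmatrix M
  open Valuation
  private module V = Setoid 𝕍

  ValAx : Set ℓ
  ValAx = Σ (Valuation M) λ v → Ax inst ⊆ D ∘ ⟦ v ⟧

  Θ : Set ℓ
  Θ = [ x ∈ List (𝒰 Sd) ∣ x ∈ LookAheadSet simple ]

  εΘ : Θ
  εΘ = List.[] , Irr.[ inj₁ refl ]

  infix 4 _≗_
  _≗_ : (f g : Θ → V) → Set ℓ
  f ≗ g = ∀ x → f x ≈ g x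

  fun : Valuation M → Formula S → Θ → V
  fun v A x = ⟦ v ⟧ (_·_ Sd (value x) A)

  V♯ : Set ℓ
  V♯ = Σ (Θ → V) λ f → Σ ValAx λ (v , _) → ∃[ A ] f ≗ fun v A

  M♯ : PNmatrix S
  M♯ = record
    { 𝕍       = record
      { Carrier       = V♯
      ; _≈_           = λ f g → proj₁ f ≗ proj₁ g
      ; isEquivalence = record
        { refl  = λ _ → V.refl
        ; sym   = λ f≗g x → V.sym (f≗g x)
        ; trans = λ f≗g g≗h x → V.trans (f≗g x) (g≗h x)
        }
      }
    ; D       = λ f → proj₁ f εΘ ∈ D
    ; D-resp  = λ f≗g → D-resp (f≗g εΘ)
    ; op      = λ c fs g → Σ ValAx λ (v , _) → ∃[ As ]
                  Pointwise (λ A f → fun v A ≗ proj₁ f) As fs ×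
                  proj₁ g ≗ fun v (con c As)
    ; op-resp = λ c fs≗gs f≗g (v , As , As≗fs , f≗) →
        v , As
      , Pointwise.trans (λ A≗f f≗g x → V.trans (A≗f x) (f≗g x)) As≗fs fs≗gs
      , λ x → V.trans (V.sym (f≗g x)) (f≗ x)
    }

-- A valuation of M♯ stores at each formula A the values of wA for all w ∈ Θ, so
-- it is determined by its ε-component v, which is a valuation of M. To see that
-- v validates an instance B⟪τ⟫ of an axiom B based on c, unfold the membership
-- of the value at c(p₁,…,pₖ)⟪τ⟫ in the output of c: it provides a valuation u
-- validating the axioms and formulas A₁,…,Aₖ such that u, under pᵢ ↦ Aᵢ, agrees
-- with v, under τ, on every w pᵢ and w c(p₁,…,pₖ) with w ∈ Θ. Hence u and v
-- agree on the atoms of the structure formula of B, and, up to the collapse of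
-- M onto a Σᵈ-deterministic matrix, on the structure formula itself. Since the
-- collapse reflects designation, v validates B⟪τ⟫ because u validates B under
-- pᵢ ↦ Aᵢ.
module Submission where

open import Data.Fin.Base using (splitAt)
open import Data.Irrelevant as Irr using ()
open import Data.List.Base as List using (List)
open import Data.List.Properties using (∷ʳ-++; ++-identityʳ)
open import Data.List.Relation.Binary.Prefix.Heterogeneous as Prefix using (Prefix)
import Data.List.Relation.Binary.Prefix.Heterogeneous.Properties as Prefixₚ
import Data.List.Relation.Binary.Pointwise as Listₚ
open import Data.Nat.Base using (ℕ)
open import Data.Nat.Properties using (_≟_)
open import Data.Product using (∃-syntax; _×_; _,_; proj₁; proj₂)
open import Data.Refinement using (value; proof; _,_)
open import Data.Sum as Sum using (inj₁; inj₂)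
open import Data.Vec.Base as Vec using (Vec; []; _∷_)
import Data.Vec.Membership.Propositional as VecMem
open import Data.Vec.Properties using (lookup-map; lookup-splitAt; map-∘)
open import Data.Vec.Relation.Binary.Pointwise.Inductive as Pointwise
  using (Pointwise; []; _∷_)
open import Data.Vec.Relation.Unary.All as All using (All; []; _∷_)
open import Data.Vec.Relation.Unary.AllPairs using ([]; _∷_)
open import Data.Vec.Relation.Unary.Any using (index)
open import Data.Vec.Relation.Unary.Any.Properties using (lookup-index)
open import Data.Vec.Relation.Unary.Unique.Propositional using (Unique)
open import Function.Base using (_∘_)
open import Function.Bundles using (_⇔_; mk⇔; Injection; Equivalence)
open import Level using (Level)
open import Relation.Binary.Bundles using (Setoid)
import Relation.Binary.Reasoning.Setoid as ≈-Reasoning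
open import Relation.Binary.PropositionalEquality
  using (_≡_; _≢_; refl; sym; trans; cong; cong₂; subst; module ≡-Reasoning)
open import Relation.Nullary using (yes; no; contradiction)
open import Relation.Unary using (Pred; _∈_; _⊆_)
open import Defs

open Valuation

private
  variable
    ℓ ℓ₁ ℓ₂ : Level
    S : Signature ℓ
    k : ℕ

-- Words, substitutions and assignments

++⇒prefix : ∀ {A : Set ℓ} (xs ys : List A) {zs} → xs List.++ ys ≡ zs →
            Prefix _≡_ xs zs
++⇒prefix List.[]       ys refl = Prefix.[]
++⇒prefix (x List.∷ xs) ys refl = refl Prefix.∷ ++⇒prefix xs ys refl

mutual
  ⟪⟫-∘ : ∀ (A : Formula S) σ τ → A ⟪ σ ⟫ ⟪ τ ⟫ ≡ A ⟪ (λ x → σ x ⟪ τ ⟫) ⟫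
  ⟪⟫-∘ (var x)    σ τ = refl
  ⟪⟫-∘ (con c As) σ τ = cong (con c) (⟪⟫*-∘ As σ τ)

  ⟪⟫*-∘ : ∀ (As : Vec (Formula S) k) σ τ →
          As ⟪ σ ⟫* ⟪ τ ⟫* ≡ As ⟪ (λ x → σ x ⟪ τ ⟫) ⟫*
  ⟪⟫*-∘ []       σ τ = refl
  ⟪⟫*-∘ (A ∷ As) σ τ = cong₂ _∷_ (⟪⟫-∘ A σ τ) (⟪⟫*-∘ As σ τ)

map-var-⟪⟫* : ∀ (xs : Vec Var k) (τ : Substitution S) →
              Vec.map var xs ⟪ τ ⟫* ≡ Vec.map τ xs
map-var-⟪⟫* []       τ = refl
map-var-⟪⟫* (x ∷ xs) τ = cong (τ x ∷_) (map-var-⟪⟫* xs τ)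

-- The substitution pᵢ ↦ Aᵢ. Variables outside the list stay fixed as a default; of repeated
-- variables the first one decides.
assign : Vec Var k → Vec (Formula S) k → Substitution S
assign []       []       y = var y
assign (x ∷ xs) (A ∷ As) y with x ≟ y
... | yes _ = A
... | no  _ = assign xs As y

assign-here : ∀ x (xs : Vec Var k) (A : Formula S) As →
              assign (x ∷ xs) (A ∷ As) x ≡ A
assign-here x xs A As with x ≟ x
... | yes _   = refl
... | no  x≢x = contradiction refl x≢x

assign-there : ∀ {x y} (xs : Vec Var k) (A : Formula S) As → x ≢ y →
               assign (x ∷ xs) (A ∷ As) y ≡ assign xs As y
assign-there {x = x} {y} xs A As x≢y with x ≟ y
... | yes x≡y = contradiction x≡y x≢y
... | no  _   = refl

map-cong-local : ∀ {A : Set ℓ₁} {B : Set ℓ₂} {f g : A → B} {xs : Vec A k} →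
                 All (λ x → f x ≡ g x) xs → Vec.map f xs ≡ Vec.map g xs
map-cong-local []         = refl
map-cong-local (eq ∷ eqs) = cong₂ _∷_ eq (map-cong-local eqs)

map-assign : ∀ {xs : Vec Var k} → Unique xs → (As : Vec (Formula S) k) →
             Vec.map (assign xs As) xs ≡ As
map-assign []                         []       = refl
map-assign {xs = x ∷ xs} (x∉xs ∷ xs!) (A ∷ As) = cong₂ _∷_
  (assign-here x xs A As)
  (trans (map-cong-local (All.map (assign-there xs A As) x∉xs))
         (map-assign xs! As))

module _ {S : Signature ℓ} (Sd : SubSignature S ℓ) where

  ·-⟪⟫ : ∀ w (A : Formula S) τ → _·_ Sd w A ⟪ τ ⟫ ≡ _·_ Sd w (A ⟪ τ ⟫)
  ·-⟪⟫ List.[]      A τ = refl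
  ·-⟪⟫ (b List.∷ w) A τ = cong (λ B → con (value b) (B ∷ [])) (·-⟪⟫ w A τ)

  -- The last letter of a word is its innermost connective, so it can pass from the word to the
  -- formula.
  ∷ʳ-· : ∀ w b (A : Formula S) →
         _·_ Sd (w List.∷ʳ b) A ≡ _·_ Sd w (con (value b) (A ∷ []))
  ∷ʳ-· List.[]      b A = refl
  ∷ʳ-· (a List.∷ w) b A = cong (λ B → con (value a) (B ∷ [])) (∷ʳ-· w b A)

-- Prefix closure of the look-ahead set

module _ {S : Signature ℓ} {Sd : SubSignature S ℓ} where

  LookAhead-prefix : ∀ {B} (s : Simple Sd B) {x y} → Prefix _≡_ x y →
                     y ∈ LookAhead s → x ∈ LookAhead s
  LookAhead-prefix s x≼y = Sum.map
    (λ (i , y≼w) → i , Prefixₚ.trans trans x≼y y≼w)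
    (λ (l , y≼u) → l , Prefixₚ.trans trans x≼y y≼u)

  LookAheadSet-prefix :
    {Ax : Pred (Formula S) ℓ} (simple : ∀ {B} → B ∈ Ax → Simple Sd B) →
    ∀ {x y} → Prefix _≡_ x y → y ∈ LookAheadSet simple → x ∈ LookAheadSet simple
  LookAheadSet-prefix simple Prefix.[] (inj₁ refl)          = inj₁ refl
  LookAheadSet-prefix simple x≼y       (inj₂ (B , B∈Ax , h)) =
    inj₂ (B , B∈Ax , LookAhead-prefix (simple B∈Ax) x≼y h)

-- Collapse of a rexpansion onto the original matrix

module Collapse {S : Signature ℓ} {M M₀ : PNmatrix S} (R : M RexpansionOf M₀) where

  private
    module M  = PNmatrix M
    module M₀ = PNmatrix M₀
    module V₀ = Setoid M₀.𝕍
    ℰ  = proj₁ (proj₂ R)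
    R′ = proj₂ (proj₂ R)
    module U = Setoid (proj₁ R)
    open ExpansionFunction ℰ
    open _RefinementOf_ R′

  collapse : M.V → M₀.V
  collapse x = Ẽ (to x)

  collapse-cong : ∀ {x y} → x M.≈ y → collapse x M₀.≈ collapse y
  collapse-cong {x} {y} x≈y = Ẽ-cong {to x} {to y} (Injection.cong incl x≈y)

  -- Designation in an expansion depends only on the fibre: by disjointness, the designated `z`
  -- whose fibre contains `to x` is `collapse x`, hence also `collapse y`.
  collapse-D : ∀ {x y} → collapse x M₀.≈ collapse y → x ∈ M.D → y ∈ M.D
  collapse-D {x} {y} x~y x∈D
    with z , z∈D , tox∈Ez ← Equivalence.to (D-incl x) x∈D =
    Equivalence.from (D-incl y)
      ( z , z∈D
      , E-resp (V₀.trans (V₀.sym x~y) (disjoint (proj₂ (proj₂ (to x))) tox∈Ez))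
               U.refl (proj₂ (proj₂ (to y))))

  collapse-op : ∀ {k} (c : S k) xs {y} → y ∈ M.op c xs →
                collapse y ∈ M₀.op c (Vec.map collapse xs)
  collapse-op c xs {y} y∈ with z , z∈ , toy∈Ez ← op-incl c xs y∈ =
    M₀.op-resp c (Pointwise.refl V₀.refl) (disjoint toy∈Ez (proj₂ (proj₂ (to y))))
      (subst (λ zs → z ∈ M₀.op c zs) (sym (map-∘ Ẽ to xs)) z∈)

  module _ {Sd : SubSignature S ℓ₁} (det : Deterministic Sd M₀)
           {Q : Pred Var ℓ₂} (u v : Valuation M) (ρ τ : Substitution S)
           (agree : ∀ {x} → x ∈ Q →
                    collapse (⟦ u ⟧ (ρ x)) M₀.≈ collapse (⟦ v ⟧ (τ x)))
           where

    mutual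
      -- Induction on `A`: at a connective of `Sd`, both collapsed values lie in one output set of
      -- `M₀`, which determinism limits to a single element.
      collapse-agree : ∀ {A} → A ∈ L Sd Q →
        collapse (⟦ u ⟧ (A ⟪ ρ ⟫)) M₀.≈ collapse (⟦ v ⟧ (A ⟪ τ ⟫))
      collapse-agree (var x∈Q) = agree x∈Q
      collapse-agree (con {c = c} {As} c∈ As∈) = det c c∈ _
        (M₀.op-resp c (collapse-agree* As∈) V₀.refl
          (collapse-op c _ (⟦⟧-con u c (As ⟪ ρ ⟫*))))
        (collapse-op c _ (⟦⟧-con v c (As ⟪ τ ⟫*)))

      collapse-agree* : ∀ {k} {As : Vec (Formula S) k} → All (L Sd Q) As →
        Pointwise M₀._≈_ (Vec.map collapse (Vec.map ⟦ u ⟧ (As ⟪ ρ ⟫*)))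
                         (Vec.map collapse (Vec.map ⟦ v ⟧ (As ⟪ τ ⟫*)))
      collapse-agree* []         = []
      collapse-agree* (A∈ ∷ As∈) = collapse-agree A∈ ∷ collapse-agree* As∈

-- The strengthened matrix as a rexpansion

module _ {S : Signature ℓ} (M : PNmatrix S) (Ax : Pred (Formula S) ℓ)
         {Sd : SubSignature S ℓ} (simple : ∀ {B} → B ∈ Ax → Simple Sd B)
         where

  open PNmatrix M
  open Strengthening M Ax simple
  private
    module V  = Setoid 𝕍
    module M♯ = PNmatrix M♯

  functionSetoid : Setoid ℓ ℓ
  functionSetoid = record
    { Carrier       = Θ → V
    ; _≈_           = _≗_
    ; isEquivalence = record
      { refl  = λ _ → V.refl
      ; sym   = λ f≗g x → V.sym (f≗g x)
      ; trans = λ f≗g g≗h x → V.trans (f≗g x) (g≗h x)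
      }
    }

  -- The fibres of evaluation at ε on all functions `Θ → V`; constant functions show that they are
  -- nonempty.
  evaluationExpansion : ExpansionFunction 𝕍 functionSetoid
  evaluationExpansion = record
    { E        = λ x f → f εΘ ≈ x
    ; E-resp   = λ x≈x′ f≗f′ fε≈x →
        V.trans (V.sym (f≗f′ εΘ)) (V.trans fε≈x x≈x′)
    ; nonempty = λ x → (λ _ → x) , V.refl
    ; disjoint = λ fε≈x fε≈x′ → V.trans (V.sym fε≈x) fε≈x′
    }

  ε-component : M♯.V → V
  ε-component f = proj₁ f εΘ

  op♯⇒op : ∀ {k} (c : S k) fs {g} → g ∈ M♯.op c fs →
           ε-component g ∈ op c (Vec.map ε-component fs)
  op♯⇒op c fs ((v , _) , As , As≗fs , g≗) =
    op-resp c (Pointwise.map⁺ (λ A≗f → A≗f εΘ) As≗fs) (V.sym (g≗ εΘ)) (⟦⟧-con v c As)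

  M♯-rexpansion : M♯ RexpansionOf M
  M♯-rexpansion = functionSetoid , evaluationExpansion , record
    { incl    = record
      { to        = to
      ; cong      = λ f≗g → f≗g
      ; injective = λ f≗g → f≗g
      }
    ; D-incl  = λ f → mk⇔ (λ fε∈D → ε-component f , fε∈D , V.refl)
                          (λ (x , x∈D , fε≈x) → D-resp (V.sym fε≈x) x∈D)
    ; op-incl = λ c fs {g} g∈ →
        ε-component g
      , subst (λ xs → ε-component g ∈ op c xs) (map-∘ Ẽ to fs) (op♯⇒op c fs {g} g∈)
      , V.refl
    }
    where
    open ExpansionFunction evaluationExpansion using (Image; Ẽ)
    to : M♯.V → Image
    to f = proj₁ f , ε-component f , V.refl

  -- Passing between valuations of `M` and of `M♯`

  raise : ValAx → Valuation M♯
  raise (v , v-Ax) = record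
    { ⟦_⟧    = λ A → fun v A , (v , v-Ax) , A , λ _ → V.refl
    ; ⟦⟧-con = λ c As → (v , v-Ax) , As , generates As , λ _ → V.refl
    }
    where
    generates : ∀ {k} (As : Vec (Formula S) k) →
      Pointwise (λ A f → fun v A ≗ proj₁ f) As
        (Vec.map (λ A → fun v A , (v , v-Ax) , A , λ _ → V.refl) As)
    generates []       = []
    generates (A ∷ As) = (λ _ → V.refl) ∷ generates As

  lower : Valuation M♯ → Valuation M
  lower v = record
    { ⟦_⟧    = ε-component ∘ ⟦ v ⟧
    ; ⟦⟧-con = λ c As → subst (λ xs → ε-component (⟦ v ⟧ (con c As)) ∈ op c xs)
        (sym (map-∘ ε-component ⟦ v ⟧ As))
        (op♯⇒op c _ {⟦ v ⟧ (con c As)} (⟦⟧-con v c As))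
    }

  -- Recovering a valuation of `M♯` from its ε-component

  module _ (v : Valuation M♯) where

    -- Induction on `w`, moving its outermost connective from the formula to the end of the
    -- look-ahead argument `x`; the concatenation `y` is invariant.
    fun-shift : ∀ x w y A → value x List.++ w ≡ value y →
                proj₁ (⟦ v ⟧ (_·_ Sd w A)) x ≈ proj₁ (⟦ v ⟧ A) y
    fun-shift x List.[] y A eq
      with refl ← trans (sym (++-identityʳ (value x))) eq = V.refl
    fun-shift x (b List.∷ w) y A eq
      -- The value at the compound formula is generated by some `u` and `B`, where `fun u B` is the
      -- value at the immediate subformula.
      with (u , _) , B ∷ [] , B≗ ∷ [] , ≗bB ← ⟦⟧-con v (value b) (_·_ Sd w A ∷ []) =
      begin
        proj₁ (⟦ v ⟧ (_·_ Sd (b List.∷ w) A)) x        ≈⟨ ≗bB x ⟩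
        ⟦ u ⟧ (_·_ Sd (value x) (con (value b) (B ∷ [])))
          ≡⟨ cong ⟦ u ⟧ (∷ʳ-· Sd (value x) b B) ⟨
        fun u B xb                                     ≈⟨ B≗ xb ⟩
        proj₁ (⟦ v ⟧ (_·_ Sd w A)) xb                  ≈⟨ fun-shift xb w y A xbw≡y ⟩
        proj₁ (⟦ v ⟧ A) y                              ∎
      where
      open ≈-Reasoning 𝕍
      xbw≡y : (value x List.∷ʳ b) List.++ w ≡ value y
      xbw≡y = trans (∷ʳ-++ (value x) b w) eq
      xb : Θ
      xb = value x List.∷ʳ b
         -- The extended argument is a prefix of `y`, so prefix closure keeps it in `Θ`.
         , Irr.map (LookAheadSet-prefix simple (++⇒prefix _ w xbw≡y)) (proof y)

    lower-· : ∀ (w : Θ) A → ⟦ lower v ⟧ (_·_ Sd (value w) A) ≈ proj₁ (⟦ v ⟧ A) w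
    lower-· w A = fun-shift εΘ (value w) w A refl

    -- Validity of axiom instances

    module _ (u : Valuation M) {B : Formula S} (B∈Ax : B ∈ Ax) where

      open SimpleBasedOn (proj₂ (proj₂ (simple B∈Ax))) renaming (w to wq; u to ur)
      private
        c = proj₁ (proj₂ (simple B∈Ax))

      module _ (As : Vec (Formula S) _) (τ : Substitution S)
               (As≗ : Pointwise (λ A f → fun u A ≗ proj₁ f) As
                        (Vec.map ⟦ v ⟧ (Vec.map var p ⟪ τ ⟫*)))
               (cAs≗ : proj₁ (⟦ v ⟧ (con c (Vec.map var p) ⟪ τ ⟫)) ≗ fun u (con c As))
               where

        private
          ρ : Substitution S
          ρ = assign p As

        -- Covers both kinds of atoms: `C` is a variable pⱼ or the formula c(p₁,...,pₖ). Since `w`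
        -- lies in `Θ`, the function values at `C` already contain those at `w · C`.
        word-agree : ∀ w C {C₁ E} → w ∈ LookAhead (simple B∈Ax) →
          E ≡ _·_ Sd w C → C ⟪ ρ ⟫ ≡ C₁ →
          fun u C₁ ≗ proj₁ (⟦ v ⟧ (C ⟪ τ ⟫)) →
          ⟦ u ⟧ (E ⟪ ρ ⟫) ≈ ⟦ lower v ⟧ (E ⟪ τ ⟫)
        word-agree w C w∈ refl refl C₁≗Cτ = begin
          ⟦ u ⟧ (_·_ Sd w C ⟪ ρ ⟫)               ≡⟨ cong ⟦ u ⟧ (·-⟪⟫ Sd w C ρ) ⟩
          fun u (C ⟪ ρ ⟫) wΘ                     ≈⟨ C₁≗Cτ wΘ ⟩
          proj₁ (⟦ v ⟧ (C ⟪ τ ⟫)) wΘ             ≈⟨ lower-· wΘ (C ⟪ τ ⟫) ⟨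
          ⟦ lower v ⟧ (_·_ Sd w (C ⟪ τ ⟫))       ≡⟨ cong ⟦ lower v ⟧ (·-⟪⟫ Sd w C τ) ⟨
          ⟦ lower v ⟧ (_·_ Sd w C ⟪ τ ⟫)         ∎
          where
          open ≈-Reasoning 𝕍
          wΘ : Θ
          wΘ = w , Irr.[ inj₂ (B , B∈Ax , w∈) ]

        assign-lookup : ∀ i → ρ (Vec.lookup p i) ≡ Vec.lookup As i
        assign-lookup i = trans (sym (lookup-map i ρ p))
          (cong (λ Bs → Vec.lookup Bs i) (map-assign p-distinct As))

        variable-agree : ∀ i →
          fun u (Vec.lookup As i) ≗ proj₁ (⟦ v ⟧ (τ (Vec.lookup p i)))
        variable-agree i = subst (λ f → fun u (Vec.lookup As i) ≗ proj₁ f)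
          (begin
            Vec.lookup (Vec.map ⟦ v ⟧ (Vec.map var p ⟪ τ ⟫*)) i
              ≡⟨ lookup-map i ⟦ v ⟧ (Vec.map var p ⟪ τ ⟫*) ⟩
            ⟦ v ⟧ (Vec.lookup (Vec.map var p ⟪ τ ⟫*) i)
              ≡⟨ cong (λ Bs → ⟦ v ⟧ (Vec.lookup Bs i)) (map-var-⟪⟫* p τ) ⟩
            ⟦ v ⟧ (Vec.lookup (Vec.map τ p) i)
              ≡⟨ cong ⟦ v ⟧ (lookup-map i τ p) ⟩
            ⟦ v ⟧ (τ (Vec.lookup p i)) ∎)
          (Pointwise.lookup As≗ i)
          where open ≡-Reasoning

        atom-agree : ∀ {x} → x VecMem.∈ q Vec.++ r →
          ⟦ u ⟧ (σ x ⟪ ρ ⟫) ≈ ⟦ lower v ⟧ (σ x ⟪ τ ⟫)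
        atom-agree x∈
          -- The position of `x` in `q ++ r` tells which kind of atom it is; its word lies in the
          -- look-ahead set as a prefix of itself.
          with splitAt n (index x∈)
             | trans (lookup-index x∈) (lookup-splitAt n q r (index x∈))
        ... | inj₁ i | refl = word-agree (wq i) _
          (inj₁ (i , Prefixₚ.fromPointwise (Listₚ.refl refl)))
          (σq i) (assign-lookup (j i)) (variable-agree (j i))
        ... | inj₂ l | refl = word-agree (ur l) _
          (inj₂ (l , Prefixₚ.fromPointwise (Listₚ.refl refl)))
          (σr l)
          (cong (con c) (trans (map-var-⟪⟫* p ρ) (map-assign p-distinct As)))
          (λ x → V.sym (cAs≗ x))

    module _ (M₀ : PNmatrix S) (det : Deterministic Sd M₀) (R : M RexpansionOf M₀) where

      open Collapse {M = M} {M₀ = M₀} R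

      lower-Ax : Ax inst ⊆ D ∘ ⟦ lower v ⟧
      lower-Ax (B , τ , B∈Ax , refl)
        with (u , u-Ax) , As , As≗ , cAs≗ ←
             ⟦⟧-con v _ (Vec.map var (SimpleBasedOn.p (proj₂ (proj₂ (simple B∈Ax)))) ⟪ τ ⟫*) =
        -- `u` validates every axiom instance, in particular the one under pᵢ ↦ Aᵢ.
        collapse-D agreement (u-Ax (B , ρ , B∈Ax , refl))
        where
        open SimpleBasedOn (proj₂ (proj₂ (simple B∈Ax))) using (p; A; A∈L; σ; B≡Aσ)
        module M₀ = PNmatrix M₀
        ρ : Substitution S
        ρ = assign p As
        -- Composing substitutions turns an instance of `B` into the structure formula with
        -- instantiated atoms, the form `collapse-agree` handles.
        instance-of-A : ∀ θ → A ⟪ (λ x → σ x ⟪ θ ⟫) ⟫ ≡ B ⟪ θ ⟫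
        instance-of-A θ = sym (trans (cong (_⟪ θ ⟫) B≡Aσ) (⟪⟫-∘ A σ θ))
        agreement : collapse (⟦ u ⟧ (B ⟪ ρ ⟫)) M₀.≈ collapse (⟦ lower v ⟧ (B ⟪ τ ⟫))
        agreement rewrite sym (instance-of-A ρ) | sym (instance-of-A τ) =
          collapse-agree det u (lower v) (λ x → σ x ⟪ ρ ⟫) (λ x → σ x ⟪ τ ⟫)
            (λ x∈ → collapse-cong (atom-agree u B∈Ax As τ As≗ cAs≗ x∈)) A∈L

theorem3p7 : ∀ {ℓ} {S : Signature ℓ} (M : PNmatrix S) (Ax : Pred (Formula S) ℓ) (Sd : SubSignature S ℓ) →
    (∃[ M₀ ] Deterministic Sd M₀ × M RexpansionOf M₀) →
    (simple : ∀ {B} → B ∈ Ax → Simple Sd B) →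
    let open Strengthening M Ax simple in
    (M♯ RexpansionOf M) ×
    (∀ Γ A → (Γ ⊢[ M ⊹ Ax ] A) ⇔ (Γ ⊢[ M♯ ] A))
theorem3p7 M Ax Sd (M₀ , det , R) simple =
    M♯-rexpansion M Ax simple
  , λ Γ A → mk⇔
      -- Designation in `M♯` is by definition designation of the ε-component, so premises and
      -- conclusion carry over unchanged in both directions.
      (λ Γ⊢A v v⊨Γ → Γ⊢A (lower M Ax simple v)
        Sum.[ v⊨Γ , lower-Ax M Ax simple v M₀ det R ])
      (λ Γ⊢A v v⊨Γ∪Ax →
        Γ⊢A (raise M Ax simple (v , λ {B} B∈ → v⊨Γ∪Ax {B} (inj₂ B∈)))
          (λ {B} B∈ → v⊨Γ∪Ax {B} (inj₁ B∈)))
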